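{- Let $q$ be a prime power and let $\mathcal{C}\subseteq \mathrm{U}(n,\mathbb{F}_q)$ be an MFRD code with minimum distance $\delta=3$. If \[ n=\frac{q^3-1}{q-1}, \] then $\mathcal{C}$ is perfect.
   Context: $\mathbb{F}_q$ is the finite field with $q$ elements. $\mathrm{U}(n,\mathbb{F}_q)$ is the $\mathbb{F}_q$-vector space of $n\times n$ upper triangular matrices over $\mathbb{F}_q$; it has dimension $\frac{n(n+1)}{2}$. For $M\in \mathrm{U}(n,\mathbb{F}_q)$ and $1\le i\le n$, $M_{[i]}$ is the $i\times(n-i+1)$ submatrix of $M$ obtained by deleting the first $i-1$ columns and the last $n-i$ rows (i.e. rows $1,\dots,i$ and columns $i,\dots,n$). The flag-rank weight of $M$ is $\mathrm{fr}(M)=\sum_{i=1}^{n}\mathrm{rk}(M_{[i]})$; the flag-rank distance is $\mathrm{d}_{\mathrm{fr}}(A,B)=\mathrm{fr}(A-B)$. A linear flag-rank-metric code is an $\mathbb{F}_q$-subspace $\mathcal{C}$ of $\mathrm{U}(n,\mathbb{F}_q)$; its minimum (flag-rank) distance, defined when $\mathcal{C}\neq\{\boldsymbol{0}\}$, is $\delta=\min\{\mathrm{fr}(M):M\in\mathcal{C}\setminus\{\boldsymbol{0}\}\}$. Its codimension is $\frac{n(n+1)}{2}-\dim_{\mathbb{F}_q}(\mathcal{C})$. Every linear flag-rank-metric code with minimum distance $\delta$ satisfies the (known) Singleton-like bound \[ \mathrm{codim}_{\mathbb{F}_q}(\mathcal{C})\ge \delta-1+\left\lfloor\sqrt{\delta-1}\right\rfloor\left\lfloor\frac{\sqrt{4(\delta-1)+1}-1}{2}\right\rfloor,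 \] and a linear flag-rank-metric code is called an MFRD (maximum flag-rank-distance) code if it attains this bound with equality. Let $b_q(n,t)=|\{A\in \mathrm{U}(n,\mathbb{F}_q):\mathrm{fr}(A)\le t\}|$. A code $\mathcal{C}$ with minimum distance $\delta$ is perfect if $|\mathcal{C}|\,b_q(n,t)=q^{\frac{n(n+1)}{2}}$, where $t=\left\lfloor\frac{\delta-1}{2}\right\rfloor$. -}

module Defs where

open import Algebra.Bundles using (CommutativeRing; AbelianGroup)
import Algebra.Construct.Pointwise as Pointwise
open import Algebra.Module.Bundles using (Module)
import Algebra.Module.Construct.TensorUnit as TensorUnit
open import Algebra.Module.Structures.Biased using (IsModuleFromLeft)
import Algebra.Properties.Monoid.Sum as MonoidSum
open import Data.Fin.Base as Fin using (Fin; toℕ; inject!; _↑ʳ_; cast)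
open import Data.Fin.Properties using (toℕ≤n)
open import Data.Nat.Base hiding (_⊔_; _/_)
open import Data.Nat.DivMod using (_/_)
open import Data.Nat.Primality using (Prime; prime⇒nonTrivial; prime⇒nonZero)
open import Data.Nat.Properties
open import Data.Product using (Σ; ∃; ∃-syntax; _×_; _,_; proj₁; proj₂)
open import Function.Base using (flip)
open import Function.Bundles using (Inverse)
open import Level using (Level; _⊔_) renaming (suc to lsuc)
open import Relation.Binary.Bundles using (Setoid)
import Relation.Binary.Construct.On as On
open import Relation.Binary.PropositionalEquality as ≡ using (_≡_; refl)
open import Relation.Nullary using (¬_; yes; no)
open import Relation.Unary using (Pred; _∈_; _⊆_)

------------------------------------------------------------------------
-- Natural numbers

IsPrimePower : ℕ → Set
IsPrimePower q = ∃[ p ] ∃[ k ] (Prime p × q ≡ p ^ suc k)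

primePower⇒nonZero : ∀ {q} → IsPrimePower q → NonZero (q ∸ 1)
primePower⇒nonZero (p , k , p-prime , refl) =
  >-nonZero (m<n⇒0<n∸m (≤-trans 1<p p≤p^1+k))
  where
  1<p : 1 < p
  1<p = nonTrivial⇒n>1 p {{prime⇒nonTrivial p-prime}}

  p≤p^1+k : p ≤ p ^ suc k
  p≤p^1+k = m≤m*n p (p ^ k) {{m^n≢0 p k {{prime⇒nonZero p-prime}}}}

largestRoot≤ : ℕ → ℕ → ℕ
largestRoot≤ m zero = 0
largestRoot≤ m (suc s) with suc s * suc s ≤? m
... | yes _ = suc s
... | no  _ = largestRoot≤ m s

⌊√_⌋ : ℕ → ℕ
⌊√ m ⌋ = largestRoot≤ m m

⌊√⌋-spec : ∀ m → ⌊√ m ⌋ * ⌊√ m ⌋ ≤ m × m < suc ⌊√ m ⌋ * suc ⌊√ m ⌋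
⌊√⌋-spec m = search m (m≤m*n (suc m) (suc m))
  where
  search : ∀ s → m < suc s * suc s → let r = largestRoot≤ m s in
           r * r ≤ m × m < suc r * suc r
  search zero    m<1 = z≤n , m<1
  search (suc s) m<[2+s]² with suc s * suc s ≤? m
  ... | yes [1+s]²≤m = [1+s]²≤m , m<[2+s]²
  ... | no  [1+s]²≰m = search s (≰⇒> [1+s]²≰m)

-- The integer part of (√x - 1)/2 is that of (⌊√x⌋ - 1)/2. Minimum distances
-- are positive and ⌊√ (4 * (δ ∸ 1) + 1) ⌋ ≥ 1, so no subtraction truncates.
singletonBound : ℕ → ℕ
singletonBound δ =
  (δ ∸ 1) + ⌊√ δ ∸ 1 ⌋ * ((⌊√ 4 * (δ ∸ 1) + 1 ⌋ ∸ 1) / 2)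

IsMinimum : ∀ {ℓ} → Pred ℕ ℓ → ℕ → Set ℓ
IsMinimum P m = m ∈ P × (∀ {k} → k ∈ P → m ≤ k)

------------------------------------------------------------------------
-- Cardinalities

HasCardinality : ∀ {a ℓ} → Setoid a ℓ → ℕ → Set (a ⊔ ℓ)
HasCardinality S m = Inverse S (≡.setoid (Fin m))

subsetoid : ∀ {a ℓ p} (S : Setoid a ℓ) → Pred (Setoid.Carrier S) p →
            Setoid (a ⊔ p) ℓ
subsetoid S P = On.setoid {B = Σ (Setoid.Carrier S) P} S proj₁

------------------------------------------------------------------------
-- Finite fields

-- The library's HeytingField carries an apartness relation, which plays no
-- role here: equality on a finite field is decidable.
record FiniteField (c ℓ : Level) (q : ℕ) : Set (lsuc (c ⊔ ℓ)) where
  field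
    commutativeRing : CommutativeRing c ℓ

  open CommutativeRing commutativeRing public
    renaming (_+_ to _+ᶠ_; _*_ to _*ᶠ_)

  field
    0≉1      : ¬ 0# ≈ 1#
    inverse  : ∀ x → ¬ x ≈ 0# → ∃[ y ] y *ᶠ x ≈ 1#
    elements : HasCardinality setoid q

------------------------------------------------------------------------
-- Linear algebra

module _ {r ℓr m ℓm : Level} {R : CommutativeRing r ℓr} where

  pointwise : ∀ {a} → Set a → Module R m ℓm → Module R (a ⊔ m) (a ⊔ ℓm)
  pointwise I M = record
    { Carrierᴹ = I → M.Carrierᴹ
    ; isModule = IsModuleFromLeft.isModule record
      { isLeftModule = record
        { isLeftSemimodule = record
          { +ᴹ-isCommutativeMonoid = G.isCommutativeMonoid
          ; isPreleftSemimodule = record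
            { *ₗ-cong      = λ x≈y u≈v i → M.*ₗ-cong x≈y (u≈v i)
            ; *ₗ-zeroˡ     = λ u i → M.*ₗ-zeroˡ (u i)
            ; *ₗ-distribʳ  = λ u x y i → M.*ₗ-distribʳ (u i) x y
            ; *ₗ-identityˡ = λ u i → M.*ₗ-identityˡ (u i)
            ; *ₗ-assoc     = λ x y u i → M.*ₗ-assoc x y (u i)
            ; *ₗ-zeroʳ     = λ x i → M.*ₗ-zeroʳ x
            ; *ₗ-distribˡ  = λ x u v i → M.*ₗ-distribˡ x (u i) (v i)
            }
          }
        ; -ᴹ‿cong    = G.⁻¹-cong
        ; -ᴹ‿inverse = G.inverse
        }
      }
    }
    where
    module M = Module M
    module G = AbelianGroup (Pointwise.abelianGroup I M.+ᴹ-abelianGroup)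

module LinearAlgebra {r ℓr m ℓm : Level}
                     {R : CommutativeRing r ℓr} (V : Module R m ℓm) where
  open CommutativeRing R using (Carrier; _≈_; 0#)
  open Module V
  open MonoidSum +ᴹ-monoid using (sum)

  linearCombination : ∀ {d} → (Fin d → Carrier) → (Fin d → Carrierᴹ) → Carrierᴹ
  linearCombination a v = sum (λ i → a i *ₗ v i)

  Span : ∀ {d} → (Fin d → Carrierᴹ) → Pred Carrierᴹ (r ⊔ ℓm)
  Span v x = ∃[ a ] x ≈ᴹ linearCombination a v

  LinearlyIndependent : ∀ {d} → (Fin d → Carrierᴹ) → Set (r ⊔ ℓr ⊔ ℓm)
  LinearlyIndependent v =
    ∀ a → linearCombination a v ≈ᴹ 0ᴹ → ∀ i → a i ≈ 0#

  IsBasisOf : ∀ {p d} → Pred Carrierᴹ p → (Fin d → Carrierᴹ) →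
              Set (p ⊔ r ⊔ ℓr ⊔ m ⊔ ℓm)
  IsBasisOf P v = (∀ i → v i ∈ P) × LinearlyIndependent v × P ⊆ Span v

  HasDimension : ∀ {p} → Pred Carrierᴹ p → ℕ → Set (p ⊔ r ⊔ ℓr ⊔ m ⊔ ℓm)
  HasDimension P d = ∃[ v ] IsBasisOf {d = d} P v

  record IsSubspace {p} (P : Pred Carrierᴹ p) : Set (p ⊔ r ⊔ m ⊔ ℓm) where
    field
      resp-≈ᴹ   : ∀ {x y} → x ≈ᴹ y → x ∈ P → y ∈ P
      0ᴹ-closed : 0ᴹ ∈ P
      +ᴹ-closed : ∀ {x y} → x ∈ P → y ∈ P → x +ᴹ y ∈ P
      *ₗ-closed : ∀ a {x} → x ∈ P → a *ₗ x ∈ P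

------------------------------------------------------------------------
-- Flag-rank-metric codes

module FlagRank {c ℓ : Level} {q : ℕ} (F : FiniteField c ℓ q) where
  open FiniteField F using (Carrier; commutativeRing; _≈_; 0#)

  vectorSpace : ℕ → Module commutativeRing c ℓ
  vectorSpace k = pointwise (Fin k) TensorUnit.⟨module⟩

  matrixSpace : ℕ → ℕ → Module commutativeRing c ℓ
  matrixSpace k l = pointwise (Fin k) (vectorSpace l)

  Matrix : ℕ → ℕ → Set c
  Matrix k l = Module.Carrierᴹ (matrixSpace k l)

  HasRank : ∀ {k l} → Matrix k l → ℕ → Set (c ⊔ ℓ)
  HasRank {k} M = HasDimension (Span (flip M))
    where open LinearAlgebra (vectorSpace k)

  module _ {n : ℕ} where
    UpperTriangular : Pred (Matrix n n) ℓ
    UpperTriangular M = ∀ i j → j Fin.< i → M i j ≈ 0#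

    -- Indices start at 0, so i : Fin n stands for i + 1 and the block consists
    -- of rows 0, …, i and columns i, …, n - 1. The entry (i, i) is its lower
    -- left corner.
    block : Matrix n n → (i : Fin n) → Matrix (suc (toℕ i)) (n ∸ toℕ i)
    block M i r s = M (inject! {i = Fin.suc i} r)
                      (cast (m+[n∸m]≡n (toℕ≤n i)) (toℕ i ↑ʳ s))

    HasFlagRank : Matrix n n → ℕ → Set (c ⊔ ℓ)
    HasFlagRank M w =
      ∃[ ρ ] ((∀ i → HasRank (block M i) (ρ i)) × w ≡ sum ρ)
      where open MonoidSum +-0-monoid using (sum)

    FlagRankBall : ℕ → Pred (Matrix n n) (c ⊔ ℓ)
    FlagRankBall t A = UpperTriangular A × ∃[ w ] (HasFlagRank A w × w ≤ t)

  record LinearCode (n : ℕ) (p : Level) : Set (c ⊔ ℓ ⊔ lsuc p) where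
    open LinearAlgebra (matrixSpace n n) using (IsSubspace)
    field
      Codeword        : Pred (Matrix n n) p
      isSubspace      : IsSubspace Codeword
      upperTriangular : Codeword ⊆ UpperTriangular

  module _ {n : ℕ} {p : Level} (C : LinearCode n p) where
    open LinearCode C
    open Module (matrixSpace n n) using (_≈ᴹ_; 0ᴹ; ≈ᴹ-setoid)
    open LinearAlgebra (matrixSpace n n) using (HasDimension)

    NonzeroWeight : Pred ℕ (c ⊔ ℓ ⊔ p)
    NonzeroWeight w = ∃[ M ] (M ∈ Codeword × ¬ M ≈ᴹ 0ᴹ × HasFlagRank M w)

    HasMinimumDistance : ℕ → Set (c ⊔ ℓ ⊔ p)
    HasMinimumDistance = IsMinimum NonzeroWeight

    HasCodimension : ℕ → Set (c ⊔ ℓ ⊔ p)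
    HasCodimension k = ∃[ d ] (HasDimension Codeword d × d + k ≡ n * suc n / 2)

    IsMFRD : Set (c ⊔ ℓ ⊔ p)
    IsMFRD = ∃[ δ ] (HasMinimumDistance δ × HasCodimension (singletonBound δ))

    IsPerfect : Set (c ⊔ ℓ ⊔ p)
    IsPerfect =
      ∃[ δ ] ∃[ a ] ∃[ b ]
        ( HasMinimumDistance δ
        × HasCardinality (subsetoid ≈ᴹ-setoid Codeword) a
        × HasCardinality (subsetoid ≈ᴹ-setoid (FlagRankBall ((δ ∸ 1) / 2))) b
        × a * b ≡ q ^ (n * suc n / 2))

-- An entry (i , j) with i ≤ j lies in the blocks i, …, j and in no other. Hence
-- a matrix of weight at most 1 has at most one nonzero entry, on the diagonal,
-- and the ball of radius 1 has 1 + n (q - 1) = q³ elements. The Singleton-like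
-- bound for δ = 3 is 3, so an MFRD code has q³ times fewer elements than the
-- whole space.

module Submission where

open import Algebra.Bundles using (CommutativeMonoid; CommutativeRing)
import Algebra.Properties.CommutativeMonoid.Sum as CommutativeMonoidSum
import Algebra.Properties.Group as GroupProperties
open import Algebra.Module.Bundles using (Module)
open import Data.Fin.Base as Fin
  using (Fin; zero; suc; toℕ; fromℕ<; inject!; cast; _↑ʳ_; combine; remQuot;
         punchIn; punchOut; finToFun; funToFin)
open import Data.Fin.Properties as Fin
  using (toℕ-injective; toℕ-fromℕ<; toℕ-cast; toℕ-↑ʳ; toℕ≤n; toℕ<n;
         remQuot-combine; combine-remQuot; punchIn-injective; punchInᵢ≢i;
         punchIn-punchOut; funToFin-finToFin; finToFun-funToFin; _≟_)
open import Data.Nat.Base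
  using (ℕ; zero; suc; NonZero; _+_; _*_; _∸_; _^_; _/_; _≤_; _<_; z≤n; s≤s; s≤s⁻¹)
open import Data.Nat.DivMod using (m/n*n≡m)
open import Data.Nat.Divisibility using (divides)
open import Data.Nat.Properties
  using (≤-refl; ≤-reflexive; ≤-trans; ≤-antisym; ≤-<-connex; n≤0⇒n≡0;
         m≤m+n; m+[n∸m]≡n; ∸-monoˡ-<; ^-distribˡ-+-*; +-cancelˡ-≡;
         m+n≡0⇒m≡0; m+n≡0⇒n≡0; +-0-commutativeMonoid)
open import Data.Nat.Tactic.RingSolver using (solve-∀)
open import Data.Product using (∃; ∃-syntax; _×_; _,_; proj₁; proj₂)
open import Data.Sum using (_⊎_; inj₁; inj₂)
open import Data.Vec.Functional using (Vector; replicate; removeAt; updateAt)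
open import Data.Vec.Functional.Properties using (updateAt-updates; updateAt-minimal)
open import Function.Base using (_∘_; const; flip)
open import Function.Bundles using (Inverse)
open import Function.Properties.Bijection using (Bijection⇒Inverse)
open import Function.Properties.Inverse using () renaming (sym to inverse-sym)
open import Level using (Level)
open import Relation.Binary.Bundles using (Setoid)
open import Relation.Binary.PropositionalEquality as ≡ using (_≡_; _≢_; refl)
import Relation.Binary.Reasoning.Setoid as ≈-Reasoning
open import Relation.Nullary using (¬_; yes; no; contradiction)
open import Relation.Unary using (Pred; _∈_)
open import Defs

-- Enumerations, cardinalities and functions with one exceptional value.

IsMinimum-unique : ∀ {ℓ} {P : Pred ℕ ℓ} {m n} → IsMinimum P m → IsMinimum P n → m ≡ n
IsMinimum-unique (m∈P , m-min) (n∈P , n-min) = ≤-antisym (m-min n∈P) (n-min m∈P)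

-- A map out of `Fin m` respects equality for free, so only injectivity and surjectivity are asked
-- for. The bijection is then reversed, because `HasCardinality` is directed from `S` to `Fin m`.
enumeration⇒HasCardinality :
  ∀ {a ℓ} (S : Setoid a ℓ) → let open Setoid S in
  ∀ {m} (f : Fin m → Carrier) → (∀ {i j} → f i ≈ f j → i ≡ j) →
  (∀ x → ∃[ i ] f i ≈ x) → HasCardinality S m
enumeration⇒HasCardinality S f injective surjective =
  inverse-sym (Bijection⇒Inverse record
    { to        = f
    ; cong      = λ { refl → S.refl }
    ; bijective = injective
                , λ x → proj₁ (surjective x) , λ { refl → proj₂ (surjective x) }
    })
  where module S = Setoid S

-- The default `z` is arbitrary so that the same construction serves coefficient vectors, matrices
-- as vectors of rows, single rows and rank profiles.
supportedAt : ∀ {a} {A : Set a} → A → ∀ {n} → Fin n → A → Vector A n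
supportedAt z i x = updateAt (replicate _ z) i (const x)

module _ {a} {A : Set a} (z : A) {n} (i : Fin n) (x : A) where

  supportedAt-at : supportedAt z i x i ≡ x
  supportedAt-at = updateAt-updates i (replicate n z)

  supportedAt-off : ∀ {j} → j ≢ i → supportedAt z i x j ≡ z
  supportedAt-off j≢i = updateAt-minimal _ i (replicate n z) j≢i

funToFin-cong : ∀ {d q} {f g : Fin d → Fin q} → (∀ i → f i ≡ g i) → funToFin f ≡ funToFin g
funToFin-cong {zero}  eq = refl
funToFin-cong {suc d} eq = ≡.cong₂ combine (eq zero) (funToFin-cong (eq ∘ suc))

-- Pointwise agreement suffices without function extensionality, since `funToFin` respects it and is
-- a left inverse of `finToFun`.
finToFun-injective : ∀ {d q} {k l : Fin (q ^ d)} →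
                     (∀ i → finToFun {q} {d} k i ≡ finToFun l i) → k ≡ l
finToFun-injective {d} {q} {k} {l} eq =
  ≡.trans (≡.sym (funToFin-finToFin {d} {q} k))
    (≡.trans (funToFin-cong {d} {q} eq) (funToFin-finToFin {d} {q} l))

-- Finite sums with at most one nonzero term.

module _ {a ℓ} (M : CommutativeMonoid a ℓ) where
  open CommutativeMonoid M
  open CommutativeMonoidSum M

  sum-zero : ∀ {n} (f : Vector Carrier n) → (∀ i → f i ≈ ε) → sum f ≈ ε
  sum-zero {n} f f≈ε = trans (sum-cong-≋ f≈ε) (sum-replicate-zero n)

  sum-single : ∀ {n} (f : Vector Carrier n) i → (∀ j → j ≢ i → f j ≈ ε) → sum f ≈ f i
  sum-single {suc n} f i f≈ε =
    trans (sum-remove f)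
      (trans (∙-congˡ (sum-zero (removeAt f i) (λ j → f≈ε _ (punchInᵢ≢i i j))))
             (identityʳ (f i)))

open CommutativeMonoidSum +-0-commutativeMonoid using (sum)

sum≡0⇒≡0 : ∀ {n} (f : Vector ℕ n) → sum f ≡ 0 → ∀ i → f i ≡ 0
sum≡0⇒≡0 f eq zero    = m+n≡0⇒m≡0 (f zero) eq
sum≡0⇒≡0 f eq (suc i) = sum≡0⇒≡0 (f ∘ suc) (m+n≡0⇒n≡0 (f zero) eq) i

-- A positive head uses up the whole bound and forces the tail to vanish; a zero head passes the
-- bound on to the tail.
sum≤1⇒single : ∀ {n} (f : Vector ℕ n) → sum f ≤ 1 →
               (∀ i → f i ≡ 0) ⊎ (∃[ i ] ∀ j → j ≢ i → f j ≡ 0)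
sum≤1⇒single {zero}  f _ = inj₁ λ ()
sum≤1⇒single {suc n} f sum≤1 with f zero in eq
... | suc m = inj₂ (zero , λ
  { zero    0≢0 → contradiction refl 0≢0
  ; (suc j) _   → sum≡0⇒≡0 (f ∘ suc) (m+n≡0⇒n≡0 m (n≤0⇒n≡0 (s≤s⁻¹ sum≤1))) j
  })
... | zero with sum≤1⇒single (f ∘ suc) sum≤1
...   | inj₁ ≡0       = inj₁ λ { zero → eq ; (suc j) → ≡0 j }
...   | inj₂ (i , ≡0) = inj₂ (suc i , λ
  { zero    _     → eq
  ; (suc j) j≢i   → ≡0 j (j≢i ∘ ≡.cong suc)
  })

-- Linear combinations, unique coordinates, spans of dimension 0 and 1.

module LinearAlgebraProperties {r ℓr m ℓm : Level}
         {R : CommutativeRing r ℓr} (V : Module R m ℓm) where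
  open CommutativeRing R
    using (Carrier; _≈_; 0#; 1#; _-_; -_)
    renaming (_+_ to _+ʳ_; trans to ≈-trans; reflexive to ≈-reflexive;
              +-assoc to +ʳ-assoc; +-congˡ to +ʳ-congˡ;
              -‿inverseˡ to -ʳ‿inverseˡ; +-identityʳ to +ʳ-identityʳ)
  open Module V
  open LinearAlgebra V
  open CommutativeMonoidSum +ᴹ-commutativeMonoid using (∑-distrib-+; sum-cong-≋)

  linearCombination-congˡ : ∀ {d} {a b : Fin d → Carrier} (v : Fin d → Carrierᴹ) →
    (∀ i → a i ≈ b i) → linearCombination a v ≈ᴹ linearCombination b v
  linearCombination-congˡ v a≈b = sum-cong-≋ (λ i → *ₗ-congʳ (a≈b i))

  linearCombination-+ : ∀ {d} (a b : Fin d → Carrier) (v : Fin d → Carrierᴹ) →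
    linearCombination (λ i → a i +ʳ b i) v ≈ᴹ linearCombination a v +ᴹ linearCombination b v
  linearCombination-+ a b v =
    ≈ᴹ-trans (sum-cong-≋ (λ i → *ₗ-distribʳ (v i) (a i) (b i)))
      (∑-distrib-+ (λ i → a i *ₗ v i) (λ i → b i *ₗ v i))

  independent⇒coefficients-unique : ∀ {d} {v : Fin d → Carrierᴹ} → LinearlyIndependent v →
    ∀ a b → linearCombination a v ≈ᴹ linearCombination b v → ∀ i → a i ≈ b i
  independent⇒coefficients-unique {v = v} independent a b a≈b i =
    GroupProperties.x∙y⁻¹≈ε⇒x≈y +-group (a i) (b i)
      (independent (λ j → a j - b j) difference≈0 i)
    where
    open CommutativeRing R using (+-group)

    difference≈0 : linearCombination (λ j → a j - b j) v ≈ᴹ 0ᴹ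
    -- Adding the combination of `b` to that of `a - b` gives the combination of `a`, which equals
    -- that of `b`; so the summand added on the left must be zero.
    difference≈0 = GroupProperties.identityˡ-unique +ᴹ-group _ (linearCombination b v)
      (≈ᴹ-trans (≈ᴹ-sym (linearCombination-+ (λ j → a j - b j) b v))
        (≈ᴹ-trans (linearCombination-congˡ v (λ j →
          ≈-trans (+ʳ-assoc (a j) (- b j) (b j))
            (≈-trans (+ʳ-congˡ (-ʳ‿inverseˡ (b j))) (+ʳ-identityʳ (a j)))))
          a≈b))

  linearCombination∈ : ∀ {p} {P : Pred Carrierᴹ p} → IsSubspace P →
    ∀ {d} {v : Fin d → Carrierᴹ} → (∀ i → v i ∈ P) → ∀ a → linearCombination a v ∈ P
  linearCombination∈ P-subspace {zero}  v∈P a = IsSubspace.0ᴹ-closed P-subspace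
  linearCombination∈ P-subspace {suc d} v∈P a =
    +ᴹ-closed (*ₗ-closed (a zero) (v∈P zero))
              (linearCombination∈ P-subspace (v∈P ∘ suc) (a ∘ suc))
    where open IsSubspace P-subspace

  v∈Span : ∀ {d} (v : Fin d → Carrierᴹ) i → v i ∈ Span v
  v∈Span v i = supportedAt 0# i 1# , ≈ᴹ-sym
    (≈ᴹ-trans (sum-single +ᴹ-commutativeMonoid _ i (λ j j≢i →
        ≈ᴹ-trans (*ₗ-congʳ (≈-reflexive (supportedAt-off 0# i 1# j≢i))) (*ₗ-zeroˡ (v j))))
      (≈ᴹ-trans (*ₗ-congʳ (≈-reflexive (supportedAt-at 0# i 1#))) (*ₗ-identityˡ (v i))))

  -- Each generator lies in the span, and the only combination of an empty basis is `0ᴹ`.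
  dimension0⇒≈0 : ∀ {d} (v : Fin d → Carrierᴹ) → HasDimension (Span v) 0 → ∀ i → v i ≈ᴹ 0ᴹ
  dimension0⇒≈0 v (_ , _ , _ , Span⊆) i = proj₂ (Span⊆ (v∈Span v i))

  ≈0⇒dimension0 : ∀ {d} (v : Fin d → Carrierᴹ) → (∀ i → v i ≈ᴹ 0ᴹ) → HasDimension (Span v) 0
  ≈0⇒dimension0 v v≈0 = (λ ()) , (λ ()) , (λ _ _ ()) , λ { (a , x≈) →
    (λ ()) , ≈ᴹ-trans x≈ (sum-zero +ᴹ-commutativeMonoid _
      (λ i → ≈ᴹ-trans (*ₗ-congˡ (v≈0 i)) (*ₗ-zeroʳ (a i)))) }

  -- The vector `v i` alone is a basis. Over a general commutative ring a nonzero vector can be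
  -- killed by a nonzero scalar, so its independence enters as a hypothesis.
  single⇒dimension1 : ∀ {d} (v : Fin d → Carrierᴹ) i → (∀ j → j ≢ i → v j ≈ᴹ 0ᴹ) →
    (∀ a → a *ₗ v i ≈ᴹ 0ᴹ → a ≈ 0#) → HasDimension (Span v) 1
  single⇒dimension1 v i v≈0 torsionFree =
    const (v i) , const (v∈Span v i)
    , (λ { a a≈0 zero → torsionFree (a zero) (≈ᴹ-trans (≈ᴹ-sym (+ᴹ-identityʳ _)) a≈0) })
    , λ { (a , x≈) → const (a i) , ≈ᴹ-trans x≈
          (≈ᴹ-trans (sum-single +ᴹ-commutativeMonoid _ i
            (λ j j≢i → ≈ᴹ-trans (*ₗ-congˡ (v≈0 j j≢i)) (*ₗ-zeroʳ (a j))))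
          (≈ᴹ-sym (+ᴹ-identityʳ _))) }

-- Which entries lie in which block.

toℕ-inject! : ∀ {n} {i : Fin (suc n)} (j : Fin (toℕ i)) → toℕ (inject! {i = i} j) ≡ toℕ j
toℕ-inject! {suc n} {suc i} zero    = refl
toℕ-inject! {suc n} {suc i} (suc j) = ≡.cong suc (toℕ-inject! j)

module _ {n : ℕ} (i : Fin n) where

  -- This and `blockColumn` repeat the index maps inside `block`, so that `block M i r s` is
  -- definitionally `M (blockRow i r) (blockColumn i s)`.
  blockRow : Fin (suc (toℕ i)) → Fin n
  blockRow = inject! {i = suc i}

  blockColumn : Fin (n ∸ toℕ i) → Fin n
  blockColumn s = cast (m+[n∸m]≡n (toℕ≤n i)) (toℕ i ↑ʳ s)

  toℕ-blockColumn : ∀ s → toℕ (blockColumn s) ≡ toℕ i + toℕ s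
  toℕ-blockColumn s = ≡.trans (toℕ-cast _ (toℕ i ↑ʳ s)) (toℕ-↑ʳ (toℕ i) s)

  blockRow≤ : ∀ r → blockRow r Fin.≤ i
  blockRow≤ r = ≤-trans (≤-reflexive (toℕ-inject! {i = suc i} r)) (s≤s⁻¹ (toℕ<n r))

  ≤blockColumn : ∀ s → i Fin.≤ blockColumn s
  ≤blockColumn s = ≤-trans (m≤m+n (toℕ i) (toℕ s)) (≤-reflexive (≡.sym (toℕ-blockColumn s)))

  -- Together with `blockColumn-surjective` and the two bounds above, this shows that block `i`
  -- covers exactly the positions `(j , k)` with `j ≤ i ≤ k`.
  blockRow-surjective : ∀ {j} → j Fin.≤ i → ∃[ r ] blockRow r ≡ j
  blockRow-surjective j≤i = fromℕ< (s≤s j≤i) ,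
    toℕ-injective (≡.trans (toℕ-inject! {i = suc i} _) (toℕ-fromℕ< (s≤s j≤i)))

  blockColumn-surjective : ∀ {j} → i Fin.≤ j → ∃[ s ] blockColumn s ≡ j
  blockColumn-surjective {j} i≤j = fromℕ< lt , toℕ-injective
    (≡.trans (toℕ-blockColumn _)
      (≡.trans (≡.cong (toℕ i +_) (toℕ-fromℕ< lt)) (m+[n∸m]≡n i≤j)))
    where
    lt : toℕ j ∸ toℕ i < n ∸ toℕ i
    lt = ∸-monoˡ-< (toℕ<n j) i≤j

  blockColumn-injective : ∀ {s t} → blockColumn s ≡ blockColumn t → s ≡ t
  blockColumn-injective {s} {t} eq = toℕ-injective (+-cancelˡ-≡ (toℕ i) _ _
    (≡.trans (≡.sym (toℕ-blockColumn s)) (≡.trans (≡.cong toℕ eq) (toℕ-blockColumn t))))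

-- Field arithmetic and the size of a subspace.

module FlagRankProperties {c ℓ : Level} {q : ℕ} (F : FiniteField c ℓ q) where
  open FlagRank F
  open FiniteField F
    using (Carrier; commutativeRing; _≈_; 0#; 1#; _*ᶠ_; inverse; elements; setoid;
           *-congʳ; *-congˡ; *-assoc; *-comm; *-identityʳ; zeroˡ; reflexive)
    renaming (refl to ≈-refl; trans to ≈-trans)
  module 𝔽 = Inverse elements

  x*y≈0⇒x≈0 : ∀ {x y} → ¬ y ≈ 0# → x *ᶠ y ≈ 0# → x ≈ 0#
  x*y≈0⇒x≈0 {x} {y} y≉0 xy≈0 with y⁻¹ , y⁻¹y≈1 ← inverse y y≉0 = begin
    x                ≈⟨ *-identityʳ x ⟨
    x *ᶠ 1#          ≈⟨ *-congˡ (≈-trans (*-comm y y⁻¹) y⁻¹y≈1) ⟨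
    x *ᶠ (y *ᶠ y⁻¹)  ≈⟨ *-assoc x y y⁻¹ ⟨
    (x *ᶠ y) *ᶠ y⁻¹  ≈⟨ *-congʳ xy≈0 ⟩
    0# *ᶠ y⁻¹        ≈⟨ zeroˡ y⁻¹ ⟩
    0#               ∎
    where open ≈-Reasoning setoid

  𝔽-from-injective : ∀ {x y} → 𝔽.from x ≈ 𝔽.from y → x ≡ y
  𝔽-from-injective {x} {y} eq =
    ≡.trans (≡.sym (𝔽.strictlyInverseˡ x)) (≡.trans (𝔽.to-cong eq) (𝔽.strictlyInverseˡ y))

  module _ {m ℓm} (V : Module commutativeRing m ℓm) where
    open Module V
    open LinearAlgebra V
    open LinearAlgebraProperties V

    -- Coordinates in a basis identify `P` with the coefficient vectors of length `d`. An element of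
    -- `Fin (q ^ d)` is read as `d` digits in base `q`, each digit naming a field element.
    dimension⇒cardinality : ∀ {p} {P : Pred Carrierᴹ p} → IsSubspace P →
      ∀ {d} → HasDimension P d → HasCardinality (subsetoid ≈ᴹ-setoid P) (q ^ d)
    dimension⇒cardinality {P = P} P-subspace {d} (v , v∈P , independent , P⊆Span) =
      enumeration⇒HasCardinality (subsetoid ≈ᴹ-setoid P)
        (λ k → linearCombination (coefficients k) v , linearCombination∈ P-subspace v∈P _)
        injective surjective
      where
      coefficients : Fin (q ^ d) → Fin d → Carrier
      coefficients k i = 𝔽.from (finToFun k i)

      injective : ∀ {k l} → linearCombination (coefficients k) v ≈ᴹ
                            linearCombination (coefficients l) v → k ≡ l
      injective k≈l = finToFun-injective (λ i →
        𝔽-from-injective (independent⇒coefficients-unique independent _ _ k≈l i))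

      surjective : ∀ ((x , _) : ∃ P) → ∃[ k ] linearCombination (coefficients k) v ≈ᴹ x
      surjective (x , x∈P) with a , x≈ ← P⊆Span x∈P =
        funToFin (𝔽.to ∘ a) , ≈ᴹ-trans
          (linearCombination-congˡ v (λ i →
            ≈-trans (𝔽.from-cong (finToFun-funToFin (𝔽.to ∘ a) i)) (𝔽.strictlyInverseʳ (a i))))
          (≈ᴹ-sym x≈)

  -- Matrices of flag rank at most 1.

  module _ {n : ℕ} where
    open Module (matrixSpace n n) using (_≈ᴹ_; 0ᴹ; ≈ᴹ-setoid)

    block≈0⇒entry≈0 : ∀ (M : Matrix n n) i → (∀ r s → block M i r s ≈ 0#) →
                      ∀ {j k} → j Fin.≤ i → i Fin.≤ k → M j k ≈ 0#
    block≈0⇒entry≈0 M i block≈0 j≤i i≤k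
      with r , refl ← blockRow-surjective i j≤i
         | s , refl ← blockColumn-surjective i i≤k = block≈0 r s

    rank0⇒block≈0 : ∀ (M : Matrix n n) i → HasRank (block M i) 0 → ∀ r s → block M i r s ≈ 0#
    rank0⇒block≈0 M i rank r s = dimension0⇒≈0 (flip (block M i)) rank s r
      where open LinearAlgebraProperties (vectorSpace (suc (toℕ i)))

    block≈0⇒rank0 : ∀ (M : Matrix n n) i → (∀ r s → block M i r s ≈ 0#) → HasRank (block M i) 0
    block≈0⇒rank0 M i block≈0 = ≈0⇒dimension0 (flip (block M i)) (flip block≈0)
      where open LinearAlgebraProperties (vectorSpace (suc (toℕ i)))

    -- The multiple by `x` of the diagonal matrix unit at `(i , i)`.
    single : Fin n → Carrier → Matrix n n
    single i x = supportedAt (const 0#) i (supportedAt 0# i x)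

    module _ (i : Fin n) (x : Carrier) where

      single-at : single i x i i ≡ x
      single-at = ≡.trans (≡.cong-app (supportedAt-at (const 0#) i _) i) (supportedAt-at 0# i x)

      single-off-row : ∀ {j} k → j ≢ i → single i x j k ≡ 0#
      single-off-row k j≢i = ≡.cong-app (supportedAt-off (const 0#) i _ j≢i) k

      single-off-column : ∀ j {k} → k ≢ i → single i x j k ≡ 0#
      single-off-column j {k} k≢i with j ≟ i
      ... | yes refl = ≡.trans (≡.cong-app (supportedAt-at (const 0#) i _) k)
                               (supportedAt-off 0# i x k≢i)
      ... | no  j≢i  = single-off-row k j≢i

      single-upperTriangular : UpperTriangular (single i x)
      single-upperTriangular j k k<j with j ≟ i
      ... | yes refl = reflexive (single-off-column j (λ { refl → Fin.<-irrefl refl k<j }))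
      ... | no  j≢i  = reflexive (single-off-row k j≢i)

      -- A block `k` that contains the position `(i , i)` satisfies `i ≤ k ≤ i`, hence is block `i`.
      single-block≈0 : ∀ {k} → k ≢ i → ∀ r s → block (single i x) k r s ≈ 0#
      single-block≈0 {k} k≢i r s with blockRow k r ≟ i
      ... | no  row≢i = reflexive (single-off-row (blockColumn k s) row≢i)
      ... | yes row≡i = reflexive (single-off-column (blockRow k r) (λ column≡i →
        k≢i (Fin.≤-antisym (≡.subst (k Fin.≤_) column≡i (≤blockColumn k s))
                           (≡.subst (Fin._≤ k) row≡i (blockRow≤ k r)))))

      single-rank1 : ¬ x ≈ 0# → HasRank (block (single i x) i) 1
      single-rank1 x≉0
        with r , row≡i    ← blockRow-surjective i {i} ≤-refl
           | s , column≡i ← blockColumn-surjective i {i} ≤-refl =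
        -- Column `s` of the block is column `i` of the matrix, the only one that can be nonzero;
        -- its entry in row `r` is `x`, so reading a vanishing multiple there forces the scalar to
        -- be zero.
        single⇒dimension1 (flip (block (single i x) i)) s
          (λ t t≢s r′ → reflexive (single-off-column (blockRow i r′) (λ column≡ →
            t≢s (blockColumn-injective i (≡.trans column≡ (≡.sym column≡i))))))
          (λ a ax≈0 → x*y≈0⇒x≈0 x≉0 (≈-trans (*-congˡ (reflexive (≡.sym corner≡x))) (ax≈0 r)))
        where
        open LinearAlgebraProperties (vectorSpace (suc (toℕ i)))
        corner≡x : single i x (blockRow i r) (blockColumn i s) ≡ x
        corner≡x = ≡.trans (≡.cong₂ (single i x) row≡i column≡i) single-at

      single-flagRank1 : ¬ x ≈ 0# → HasFlagRank (single i x) 1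
      single-flagRank1 x≉0 = ρ , rank
        , ≡.sym (≡.trans (sum-single +-0-commutativeMonoid ρ i
                           (λ j j≢i → supportedAt-off 0 i 1 j≢i))
                         (supportedAt-at 0 i 1))
        where
        ρ = supportedAt 0 i 1
        rank : ∀ k → HasRank (block (single i x) k) (ρ k)
        rank k with k ≟ i
        ... | yes refl = ≡.subst (HasRank _) (≡.sym (supportedAt-at 0 i 1)) (single-rank1 x≉0)
        ... | no  k≢i  = ≡.subst (HasRank _) (≡.sym (supportedAt-off 0 i 1 k≢i))
                           (block≈0⇒rank0 (single i x) k (single-block≈0 k≢i))

    -- Both matrices are compared at `(i , i)`, where the right one vanishes if `j` differs from
    -- `i`. A zero entry would not remember its position, hence `x` is nonzero.
    single-injective : ∀ {i j x y} → ¬ x ≈ 0# → single i x ≈ᴹ single j y → i ≡ j × x ≈ y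
    single-injective {i} {j} {x} {y} x≉0 eq with i ≟ j
    ... | yes refl = refl , ≈-trans (reflexive (≡.sym (single-at i x)))
                              (≈-trans (eq i i) (reflexive (single-at i y)))
    ... | no  i≢j  = contradiction
      (≈-trans (reflexive (≡.sym (single-at i x)))
        (≈-trans (eq i i) (reflexive (single-off-row j y i i≢j)))) x≉0

    single≉0 : ∀ {i x} → ¬ x ≈ 0# → ¬ single i x ≈ᴹ 0ᴹ
    single≉0 {i} {x} x≉0 eq = x≉0 (≈-trans (reflexive (≡.sym (single-at i x))) (eq i i))

    0∈ball : ∀ t → 0ᴹ ∈ FlagRankBall t
    0∈ball t = (λ _ _ _ → ≈-refl) , 0
      , (const 0 , (λ i → block≈0⇒rank0 0ᴹ i (λ _ _ → ≈-refl))
                 , ≡.sym (sum-zero +-0-commutativeMonoid {n} (const 0) (λ _ → refl)))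
      , z≤n

    -- The ranks sum to at most 1, so all blocks vanish except possibly one, block `i`. The entry
    -- `M i i` may still be zero in the second case.
    ball1⇒single : ∀ (M : Matrix n n) → M ∈ FlagRankBall 1 →
                   M ≈ᴹ 0ᴹ ⊎ (∃[ i ] M ≈ᴹ single i (M i i))
    ball1⇒single M (upper , w , (ρ , rank , refl) , w≤1) with sum≤1⇒single ρ w≤1
    ... | inj₁ ρ≡0 = inj₁ entry≈0
      where
      entry≈0 : M ≈ᴹ 0ᴹ
      entry≈0 j k with ≤-<-connex (toℕ j) (toℕ k)
      ... | inj₁ j≤k = vanishing j ≤-refl j≤k
        where
        -- Any block between `j` and `k` shows that the entry is zero; block `j` is taken above.
        vanishing : ∀ i → j Fin.≤ i → i Fin.≤ k → M j k ≈ 0#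
        vanishing i = block≈0⇒entry≈0 M i (rank0⇒block≈0 M i (≡.subst (HasRank _) (ρ≡0 i) (rank i)))
      ... | inj₂ k<j = upper j k k<j
    ... | inj₂ (i , ρ≡0) = inj₂ (i , entry≈)
      where
      vanishing : ∀ l → l ≢ i → ∀ {j k} → j Fin.≤ l → l Fin.≤ k → M j k ≈ 0#
      vanishing l l≢i = block≈0⇒entry≈0 M l
        (rank0⇒block≈0 M l (≡.subst (HasRank _) (ρ≡0 l l≢i) (rank l)))

      entry≈ : M ≈ᴹ single i (M i i)
      -- For `j ≤ k` the entry lies in both block `j` and block `k`. Away from `(i , i)` one of the
      -- two indices differs from `i`, and that block vanishes.
      entry≈ j k with j ≟ i | k ≟ i | ≤-<-connex (toℕ j) (toℕ k)
      ... | yes refl | yes refl | _ = reflexive (≡.sym (single-at i (M i i)))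
      ... | no j≢i | _ | inj₁ j≤k =
        ≈-trans (vanishing j j≢i ≤-refl j≤k) (reflexive (≡.sym (single-off-row i _ k j≢i)))
      ... | no j≢i | _ | inj₂ k<j =
        ≈-trans (upper j k k<j) (reflexive (≡.sym (single-off-row i _ k j≢i)))
      ... | yes refl | no k≢i | inj₁ j≤k =
        ≈-trans (vanishing k k≢i j≤k ≤-refl) (reflexive (≡.sym (single-off-column i _ j k≢i)))
      ... | yes refl | no k≢i | inj₂ k<j =
        ≈-trans (upper j k k<j) (reflexive (≡.sym (single-off-column i _ j k≢i)))

-- Size of the ball of radius 1, over a field with `m` nonzero elements.

module _ {c ℓ : Level} {m : ℕ} (F : FiniteField c ℓ (suc m)) (n : ℕ) where
  open FlagRank F
  open FlagRankProperties F
  open FiniteField F using (Carrier; _≈_; 0#)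
    renaming (refl to ≈-refl; sym to ≈-sym; trans to ≈-trans)
  open Module (matrixSpace n n) using (_≈ᴹ_; 0ᴹ; ≈ᴹ-setoid; ≈ᴹ-sym; ≈ᴹ-trans)

  -- `punchIn` skips the index of `0#`, so the `m` remaining indices list the nonzero elements.
  nonzeroElement : Fin m → Carrier
  nonzeroElement y = 𝔽.from (punchIn (𝔽.to 0#) y)

  nonzeroElement≉0 : ∀ y → ¬ nonzeroElement y ≈ 0#
  nonzeroElement≉0 y eq = punchInᵢ≢i (𝔽.to 0#) y
    (≡.trans (≡.sym (𝔽.strictlyInverseˡ _)) (𝔽.to-cong eq))

  nonzeroElement-injective : ∀ {y z} → nonzeroElement y ≈ nonzeroElement z → y ≡ z
  nonzeroElement-injective {y} {z} eq =
    punchIn-injective (𝔽.to 0#) y z (𝔽-from-injective eq)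

  zero⊎nonzeroElement : ∀ x → x ≈ 0# ⊎ (∃[ y ] nonzeroElement y ≈ x)
  zero⊎nonzeroElement x with 𝔽.to 0# ≟ 𝔽.to x
  ... | yes 0≡x = inj₁ (≈-trans (≈-sym (𝔽.strictlyInverseʳ x))
                    (≈-trans (𝔽.from-cong (≡.sym 0≡x)) (𝔽.strictlyInverseʳ 0#)))
  ... | no  0≢x = inj₂ (punchOut 0≢x ,
    ≈-trans (𝔽.from-cong (punchIn-punchOut 0≢x)) (𝔽.strictlyInverseʳ x))

  single-cong : ∀ (i : Fin n) {x y} → x ≈ y → single i x ≈ᴹ single i y
  single-cong i {x} {y} x≈y j k with j ≟ i | k ≟ i
  ... | yes refl | yes refl rewrite single-at i x | single-at i y = x≈y
  ... | no j≢i | _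
    rewrite single-off-row i x k j≢i | single-off-row i y k j≢i = ≈-refl
  ... | yes refl | no k≢i
    rewrite single-off-column i x j k≢i | single-off-column i y j k≢i = ≈-refl

  single-0 : ∀ (i : Fin n) → single i 0# ≈ᴹ 0ᴹ
  single-0 i j k with j ≟ i | k ≟ i
  ... | yes refl | yes refl rewrite single-at i 0# = ≈-refl
  ... | no j≢i | _ rewrite single-off-row i 0# k j≢i = ≈-refl
  ... | yes refl | no k≢i rewrite single-off-column i 0# j k≢i = ≈-refl

  -- Index 0 stands for the zero matrix; the other `n * m` indices encode a diagonal position
  -- together with a nonzero entry.
  ball1-cardinality : HasCardinality (subsetoid ≈ᴹ-setoid (FlagRankBall {n} 1)) (suc (n * m))
  ball1-cardinality = enumeration⇒HasCardinality _ (λ k → point k , point∈ball k)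
    (λ {k} {l} → injective k l) surjective
    where
    diagonal : Fin n × Fin m → Matrix n n
    diagonal (i , y) = single i (nonzeroElement y)

    diagonal∈ball : ∀ p → diagonal p ∈ FlagRankBall 1
    diagonal∈ball (i , y) =
      single-upperTriangular i _ , 1 , single-flagRank1 i _ (nonzeroElement≉0 y) , ≤-refl

    diagonal-injective : ∀ p p′ → diagonal p ≈ᴹ diagonal p′ → p ≡ p′
    diagonal-injective (i , y) (j , z) eq
      with refl , y≈z ← single-injective (nonzeroElement≉0 y) eq =
      ≡.cong (i ,_) (nonzeroElement-injective y≈z)

    point : Fin (suc (n * m)) → Matrix n n
    point zero    = 0ᴹ
    point (suc k) = diagonal (remQuot m k)

    point∈ball : ∀ k → point k ∈ FlagRankBall 1
    point∈ball zero    = 0∈ball 1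
    point∈ball (suc k) = diagonal∈ball (remQuot m k)

    injective : ∀ k l → point k ≈ᴹ point l → k ≡ l
    injective zero    zero    _  = refl
    injective zero    (suc l) eq = contradiction (≈ᴹ-sym eq) (single≉0 (nonzeroElement≉0 _))
    injective (suc k) zero    eq = contradiction eq (single≉0 (nonzeroElement≉0 _))
    injective (suc k) (suc l) eq = ≡.cong suc
      (≡.trans (≡.sym (combine-remQuot {n} m k))
        (≡.trans (≡.cong (λ (i , y) → combine i y)
                   (diagonal-injective (remQuot m k) (remQuot m l) eq))
          (combine-remQuot {n} m l)))

    surjective : ∀ ((M , _) : ∃ (FlagRankBall 1)) → ∃[ k ] point k ≈ᴹ M
    surjective (M , M∈ball) with ball1⇒single M M∈ball
    ... | inj₁ M≈0 = zero , ≈ᴹ-sym M≈0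
    ... | inj₂ (i , M≈) with zero⊎nonzeroElement (M i i)
    -- The diagonal entry supplied by `ball1⇒single` can be zero, and then `M` is the zero matrix.
    ...   | inj₁ ≈0 = zero , ≈ᴹ-sym (≈ᴹ-trans M≈ (≈ᴹ-trans (single-cong i ≈0) (single-0 i)))
    ...   | inj₂ (y , y≈) = suc (combine i y) ,
      ≡.subst (λ p → diagonal p ≈ᴹ M) (≡.sym (remQuot-combine i y))
        (≈ᴹ-trans (single-cong i y≈) (≈ᴹ-sym M≈))

-- Arithmetic of the parameters and the perfect code.

geometricSum : ∀ m .{{_ : NonZero m}} → (suc m ^ 3 ∸ 1) / m * m ≡ suc m ^ 3 ∸ 1
-- The quotient is `q² + q + 1` expanded at `q = m + 1`.
geometricSum m = m/n*n≡m (divides (m * m + 3 * m + 3) (≡.cong (_∸ 1) (cube m)))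
  where
  -- The left side is what `suc m ^ 3` reduces to; the outer `suc` on the right absorbs the `∸ 1`.
  cube : ∀ m → suc m * (suc m * (suc m * 1)) ≡ suc ((m * m + 3 * m + 3) * m)
  cube = solve-∀

corollary5p5 : {c ℓ p : Level} (q n : ℕ) (q-primePower : IsPrimePower q)
    (F : FiniteField c ℓ q) → let open FlagRank F in
    (C : LinearCode n p) →
    IsMFRD C → HasMinimumDistance C 3 →
    n ≡ _/_ (q ^ 3 ∸ 1) (q ∸ 1) {{primePower⇒nonZero q-primePower}} →
    IsPerfect C
-- The element `0#` rules out a field of size zero, which leaves `q = suc m`.
corollary5p5 zero _ _ F _ _ _ _ = contradiction (Inverse.to elements 0#) Fin.¬Fin0
  where open FiniteField F using (elements; 0#)
corollary5p5 (suc m) n q-primePower F C (δ , δ-min , d , dim , d+codim≡) 3-min n≡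
  -- The distance packed into `IsMFRD` must be 3, and `singletonBound 3` then computes to 3, so
  -- `d+codim≡` reads `d + 3 ≡ n * suc n / 2`.
  with refl ← IsMinimum-unique δ-min 3-min =
  3 , suc m ^ d , suc (n * m) , 3-min
  , dimension⇒cardinality (matrixSpace n n) (LinearCode.isSubspace C) dim
  -- The packing radius `(3 ∸ 1) / 2` evaluates to 1.
  , ball1-cardinality F n
  , (begin
      suc m ^ d * suc (n * m)      ≡⟨ ≡.cong (suc m ^ d *_) ball≡ ⟩
      suc m ^ d * suc m ^ 3        ≡⟨ ^-distribˡ-+-* (suc m) d 3 ⟨
      suc m ^ (d + 3)              ≡⟨ ≡.cong (suc m ^_) d+codim≡ ⟩
      suc m ^ (n * suc n / 2)      ∎)
  where
  open FlagRank F
  open FlagRankProperties F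
  open ≡.≡-Reasoning
  instance
    m≢0 : NonZero m
    m≢0 = primePower⇒nonZero q-primePower

  ball≡ : suc (n * m) ≡ suc m ^ 3
  ball≡ = ≡.cong suc (≡.trans (≡.cong (_* m) n≡) (geometricSum m))
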